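{- Let $G$ be a comb (with at least one vertex) and let $D$ be an orientation of $G$. Then $D$ has a vertex $v$ with $d^{+}_D(v)\le d^{++}_D(v)$.
   Context: Graphs are finite and simple. An orientation of $G$ is the digraph obtained by replacing each edge of $G$ by exactly one of its two possible arcs. For a vertex $v$ of $D$, $N^{+}_D(v)$ is the set of out-neighbors of $v$ and $d^{+}_D(v)=|N^{+}_D(v)|$. $N^{++}_D(v)$ is the set of vertices at distance exactly 2 from $v$ (out-neighbors of out-neighbors of $v$, excluding $N^{+}_D(v)$); $d^{++}_D(v)=|N^{++}_D(v)|$. A chair is a graph on 5 distinct vertices $x,y,z,t,v$ whose edges are exactly $xy,yz,zt,zv$; the co-chair is its complement. $C_n$ is the cycle on $n$ vertices and $\overline{H}$ is the complement of $H$. A comb is a graph having no induced subgraph isomorphic to $C_4$, $\overline{C_4}$, $C_5$, chair or co-chair. -}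

module Defs where

open import Data.Fin using (Fin; toℕ; #_)
open import Data.Fin.Properties using (_≟_; any?)
open import Data.Fin.Subset using (Subset; ∣_∣)
open import Data.List using (List; []; _∷_)
open import Data.List.Membership.DecPropositional using (_∈?_)
open import Data.List.Membership.Propositional using (_∈_)
open import Data.Nat using (ℕ; suc; NonZero)
import Data.Nat as ℕ
open import Data.Nat.DivMod using (_%_)
open import Data.Product using (_×_; _,_; ∃)
open import Data.Product.Properties using (≡-dec)
open import Data.Sum using (_⊎_; swap)
open import Data.Vec using (tabulate)
open import Function using (_∘_)
open import Function.Bundles using (_⇔_)
open import Function.Definitions using (Injective)
open import Level using (0ℓ)
open import Relation.Binary using (Rel; Decidable; Symmetric; Irreflexive; Asymmetric)
open import Relation.Binary.PropositionalEquality using (_≡_; _≢_; sym)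
open import Relation.Nullary using (¬_; ¬?; does; _×-dec_; _⊎-dec_)
import Relation.Unary as U

------------------------------------------------------------------------
-- Finite simple graphs

record Graph (n : ℕ) : Set₁ where
  field
    Adj        : Rel (Fin n) 0ℓ
    adj?       : Decidable Adj
    adj-sym    : Symmetric Adj
    adj-irrefl : Irreflexive _≡_ Adj

open Graph

-- Loops of R are discarded.
fromRel : ∀ {n} {R : Rel (Fin n) 0ℓ} → Decidable R → Graph n
fromRel {R = R} R? = record
  { Adj        = λ i j → i ≢ j × (R i j ⊎ R j i)
  ; adj?       = λ i j → ¬? (i ≟ j) ×-dec (R? i j ⊎-dec R? j i)
  ; adj-sym    = λ (i≢j , r) → (i≢j ∘ sym) , swap r
  ; adj-irrefl = λ i≡j (i≢j , _) → i≢j i≡j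
  }

complement : ∀ {n} → Graph n → Graph n
complement G = record
  { Adj        = λ i j → i ≢ j × ¬ Adj G i j
  ; adj?       = λ i j → ¬? (i ≟ j) ×-dec ¬? (adj? G i j)
  ; adj-sym    = λ (i≢j , ¬ij) → (i≢j ∘ sym) , (¬ij ∘ adj-sym G)
  ; adj-irrefl = λ i≡j (i≢j , _) → i≢j i≡j
  }

-- This is the cycle Cₙ for n ≥ 3.
cycle : ∀ n .{{_ : NonZero n}} → Graph n
cycle n = fromRel {R = λ i j → toℕ j ≡ suc (toℕ i) % n}
                  (λ i j → toℕ j ℕ.≟ suc (toℕ i) % n)

-- The vertices x, y, z, t, v are numbered 0, 1, 2, 3, 4.
chairEdges : List (Fin 5 × Fin 5)
chairEdges = (# 0 , # 1) ∷ (# 1 , # 2) ∷ (# 2 , # 3) ∷ (# 2 , # 4) ∷ []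

chair : Graph 5
chair = fromRel {R = λ i j → (i , j) ∈ chairEdges}
                (λ i j → _∈?_ (≡-dec _≟_ _≟_) (i , j) chairEdges)

co-chair : Graph 5
co-chair = complement chair

-- An isomorphism from H onto the subgraph of G induced by the image of f.
record InducedCopy {m n : ℕ} (H : Graph m) (G : Graph n) : Set where
  field
    f         : Fin m → Fin n
    injective : Injective _≡_ _≡_ f
    adj-iff   : ∀ i j → Adj H i j ⇔ Adj G (f i) (f j)

record IsComb {n : ℕ} (G : Graph n) : Set where
  field
    no-C₄       : ¬ InducedCopy (cycle 4) G
    no-co-C₄    : ¬ InducedCopy (complement (cycle 4)) G
    no-C₅       : ¬ InducedCopy (cycle 5) G
    no-chair    : ¬ InducedCopy chair G
    no-co-chair : ¬ InducedCopy co-chair G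

------------------------------------------------------------------------
-- Digraphs, orientations and out-neighbourhoods

record Digraph (n : ℕ) : Set₁ where
  field
    Arc  : Rel (Fin n) 0ℓ
    arc? : Decidable Arc

open Digraph

record IsOrientation {n : ℕ} (G : Graph n) (D : Digraph n) : Set where
  field
    arc⇒adj  : ∀ {u v} → Arc D u v → Adj G u v
    adj⇒arc  : ∀ {u v} → Adj G u v → Arc D u v ⊎ Arc D v u
    arc-asym : Asymmetric (Arc D)

-- w is at distance exactly 2 from v (so in particular w is not v itself).
SecondOutNeighbour : ∀ {n} → Digraph n → Rel (Fin n) 0ℓ
SecondOutNeighbour D v w =
  w ≢ v × ¬ Arc D v w × ∃ λ u → Arc D v u × Arc D u w

secondOutNeighbour? : ∀ {n} (D : Digraph n) → Decidable (SecondOutNeighbour D)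
secondOutNeighbour? D v w =
  ¬? (w ≟ v) ×-dec ¬? (arc? D v w) ×-dec any? (λ u → arc? D v u ×-dec arc? D u w)

subsetOf : ∀ {n} {P : U.Pred (Fin n) 0ℓ} → U.Decidable P → Subset n
subsetOf P? = tabulate (does ∘ P?)

N⁺ : ∀ {n} → Digraph n → Fin n → Subset n
N⁺ D v = subsetOf (arc? D v)

N⁺⁺ : ∀ {n} → Digraph n → Fin n → Subset n
N⁺⁺ D v = subsetOf (secondOutNeighbour? D v)

d⁺ : ∀ {n} → Digraph n → Fin n → ℕ
d⁺ D v = ∣ N⁺ D v ∣

d⁺⁺ : ∀ {n} → Digraph n → Fin n → ℕ
d⁺⁺ D v = ∣ N⁺⁺ D v ∣

{-# OPTIONS --safe #-}

-- Havet and Thomassé's median order argument, applied to the relation "u w is an arc, or a missing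
-- edge conveniently oriented from u to w" instead of a tournament. Let f be the last vertex of a
-- median order and let w be reached from f neither in one nor in two steps. The argument requires
-- every out-neighbour u of f in a block preceding w to be dominated by w. If it is not, then
-- f ~ u ≁ w ~ x ≁ f is an alternating 4-cycle for some x, and in a comb f and w determine u. So at
-- most one domination is missing for each w, and this deficit is made up by choosing, among the
-- median orders ending in f, one that as often as possible places such w before u.

module Submission where

open import Defs
open import Data.Bool using (Bool; true; false; if_then_else_)
open import Data.Empty using (⊥; ⊥-elim)
open import Data.Fin as Fin using (Fin; zero; suc)
open import Data.Fin.Properties using (_≟_; <-cmp; any?; all?; ¬∀⟶∃¬)
open import Data.Fin.Subset using (∣_∣)
open import Data.List as List using (List; []; _∷_; _++_; map; length; allFin)
open import Data.List.Properties using (map-tabulate)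
open import Data.List.Relation.Binary.Permutation.Propositional
  using (_↭_; ↭-refl; ↭-sym; ↭-trans; prep; ↭⇒↭ₛ)
open import Data.List.Relation.Binary.Permutation.Propositional.Properties
  using (map⁺; ↭-length; shift)
open import Data.List.Relation.Binary.Permutation.Setoid.Properties using (Unique-resp-↭)
open import Data.List.Relation.Unary.All as All using (All; []; _∷_)
open import Data.List.Relation.Unary.All.Properties using (++⁻ˡ)
open import Data.List.Relation.Unary.AllPairs using ([]; _∷_)
open import Data.List.Relation.Unary.Unique.Propositional using (Unique)
open import Data.List.Relation.Unary.Unique.Propositional.Properties using (allFin⁺)
open import Data.Nat
  using (ℕ; zero; suc; NonZero; _+_; _*_; _≤_; _<_; z≤n; s≤s; s<s; _<?_)
open import Data.Nat.ListAction using (sum)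
open import Data.Nat.ListAction.Properties using (sum-↭)
open import Data.Nat.Properties hiding (_≟_; <-cmp)
open import Data.Nat.Tactic.RingSolver using (solve-∀)
open import Data.Product using (∃; ∃₂; _×_; _,_; proj₁; proj₂)
open import Data.Sum using (_⊎_; inj₁; inj₂; [_,_]′)
open import Data.Vec as Vec using (Vec; []; _∷_; lookup)
open import Data.Vec.Properties using (lookup-allFin)
open import Data.Vec.Relation.Unary.All using ([]; _∷_)
open import Data.Vec.Relation.Unary.All.Properties using (lookup⁺)
open import Data.Vec.Relation.Unary.AllPairs as VecAllPairs using ([]; _∷_)
open import Function using (_∘_; id; mk⇔)
open import Level using (0ℓ)
open import Relation.Binary using (tri<; tri≈; tri>)
open import Relation.Binary.PropositionalEquality
  using (_≡_; _≢_; refl; sym; trans; cong; cong₂; subst; subst₂; setoid; module ≡-Reasoning)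
open import Relation.Nullary
  using (¬_; Dec; yes; no; does; ¬?; _×-dec_; _→-dec_; _⊎-dec_; contradiction)
open import Relation.Nullary.Decidable using (decidable-stable)
open import Relation.Unary using (Pred; Decidable)

open IsComb

-- Induced subgraphs of combs

AllPairs-lookup : ∀ {A : Set} {R : A → A → Set} {m} {xs : Vec A m} →
                  VecAllPairs.AllPairs R xs → ∀ {i j} → i Fin.< j → R (lookup xs i) (lookup xs j)
AllPairs-lookup (r ∷ _)  {zero}  {suc j} _         = lookup⁺ r j
AllPairs-lookup (_ ∷ rs) {suc i} {suc j} (s<s i<j) = AllPairs-lookup rs i<j

module _ {n : ℕ} (G : Graph n) where

  open Graph

  infix 4 _~_ _≁_

  _~_ _≁_ : Fin n → Fin n → Set
  _~_ = Adj G
  _≁_ = Adj (complement G)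

  private variable a b c d e f u u′ w x x′ : Fin n

  ≁-sym : a ≁ b → b ≁ a
  ≁-sym = adj-sym (complement G)

  ~⇒≢ : a ~ b → a ≢ b
  ~⇒≢ ab a≡b = adj-irrefl G a≡b ab

  ~-or-≁ : a ≢ b → a ~ b ⊎ a ≁ b
  ~-or-≁ {a} {b} a≢b with adj? G a b
  ... | yes ab = inj₁ ab
  ... | no ¬ab = inj₂ (a≢b , ¬ab)

  ~-≁⇒≢ : a ~ b → b ≁ c → a ≢ c
  ~-≁⇒≢ ab (_ , ¬bc) refl = ¬bc (adj-sym G ab)

  Matches : Bool → Fin n → Fin n → Set
  Matches true  = _~_
  Matches false = _≁_

  Matches-≢ : ∀ β → Matches β a b → a ≢ b
  Matches-≢ true  ab        = ~⇒≢ ab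
  Matches-≢ false (a≢b , _) = a≢b

  -- For a concrete `H` the Booleans `does (adj? H i j)` compute, so `pairs` becomes a table of
  -- adjacencies and non-adjacencies. Pairs with `i < j` suffice by symmetry; either relation makes
  -- the vertices distinct.
  inducedCopy : ∀ {m} (H : Graph m) (vs : Vec (Fin n) m) →
                VecAllPairs.AllPairs
                  (λ i j → Matches (does (adj? H i j)) (lookup vs i) (lookup vs j)) (Vec.allFin m) →
                InducedCopy H G
  inducedCopy {m} H vs pairs = record
    { f = lookup vs ; injective = injective ; adj-iff = λ i j → mk⇔ (to i j) (from i j) }
    where
    M : Fin m → Fin m → Set
    M i j = Matches (does (adj? H i j)) (lookup vs i) (lookup vs j)

    matches : ∀ {i j} → i Fin.< j → M i j
    matches i<j = subst₂ M (lookup-allFin _) (lookup-allFin _) (AllPairs-lookup pairs i<j)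

    ascending : ∀ {i j} → i Fin.< j → (Adj H i j → lookup vs i ~ lookup vs j) ×
                                  (lookup vs i ~ lookup vs j → Adj H i j)
    ascending {i} {j} i<j with adj? H i j | matches i<j
    ... | yes ij | vivj       = (λ _ → vivj) , (λ _ → ij)
    ... | no ¬ij | (_ , ¬vivj) = (λ ij → ⊥-elim (¬ij ij)) , (λ vivj → ⊥-elim (¬vivj vivj))

    injective : ∀ {i j} → lookup vs i ≡ lookup vs j → i ≡ j
    injective {i} {j} eq with <-cmp i j
    ... | tri≈ _ i≡j _ = i≡j
    ... | tri< i<j _ _ = ⊥-elim (Matches-≢ (does (adj? H i j)) (matches i<j) eq)
    ... | tri> _ _ j<i = ⊥-elim (Matches-≢ (does (adj? H j i)) (matches j<i) (sym eq))

    to : ∀ i j → Adj H i j → lookup vs i ~ lookup vs j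
    to i j ij with <-cmp i j
    ... | tri< i<j _ _ = proj₁ (ascending i<j) ij
    ... | tri≈ _ i≡j _ = ⊥-elim (adj-irrefl H i≡j ij)
    ... | tri> _ _ j<i = adj-sym G (proj₁ (ascending j<i) (adj-sym H ij))

    from : ∀ i j → lookup vs i ~ lookup vs j → Adj H i j
    from i j vivj with <-cmp i j
    ... | tri< i<j _ _ = proj₂ (ascending i<j) vivj
    ... | tri≈ _ i≡j _ = ⊥-elim (adj-irrefl G (cong (lookup vs) i≡j) vivj)
    ... | tri> _ _ j<i = adj-sym H (proj₂ (ascending j<i) (adj-sym G vivj))

  -- Forbidden subgraphs and alternating 4-cycles

  module _ (comb : IsComb G) where

    C₄-free : a ~ b → b ~ c → c ~ d → d ~ a → a ≁ c → b ≁ d → ⊥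
    C₄-free {a} {b} {c} {d} ab bc cd da ac bd = no-C₄ comb
      (inducedCopy (cycle 4) (a ∷ b ∷ c ∷ d ∷ [])
        ((ab ∷ ac ∷ adj-sym G da ∷ []) ∷ (bc ∷ bd ∷ []) ∷ (cd ∷ []) ∷ [] ∷ []))

    2K₂-free : a ~ b → c ~ d → a ≁ c → a ≁ d → b ≁ c → b ≁ d → ⊥
    2K₂-free {a} {b} {c} {d} ab cd ac ad bc bd = no-co-C₄ comb
      -- The complement consists of the two diagonals of the 4-cycle, hence this vertex order.
      (inducedCopy (complement (cycle 4)) (a ∷ c ∷ b ∷ d ∷ [])
        ((ac ∷ ab ∷ ad ∷ []) ∷ (≁-sym bc ∷ cd ∷ []) ∷ (bd ∷ []) ∷ [] ∷ []))

    C₅-free : a ~ b → b ~ c → c ~ d → d ~ e → e ~ a →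
              a ≁ c → a ≁ d → b ≁ d → b ≁ e → c ≁ e → ⊥
    C₅-free {a} {b} {c} {d} {e} ab bc cd de ea ac ad bd be ce = no-C₅ comb
      (inducedCopy (cycle 5) (a ∷ b ∷ c ∷ d ∷ e ∷ [])
        ((ab ∷ ac ∷ ad ∷ adj-sym G ea ∷ []) ∷ (bc ∷ bd ∷ be ∷ []) ∷ (cd ∷ ce ∷ []) ∷
         (de ∷ []) ∷ [] ∷ []))

    chair-free : a ~ b → b ~ c → c ~ d → c ~ e →
                 a ≁ c → a ≁ d → a ≁ e → b ≁ d → b ≁ e → d ≁ e → ⊥
    chair-free {a} {b} {c} {d} {e} ab bc cd ce ac ad ae bd be de = no-chair comb
      (inducedCopy chair (a ∷ b ∷ c ∷ d ∷ e ∷ [])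
        ((ab ∷ ac ∷ ad ∷ ae ∷ []) ∷ (bc ∷ bd ∷ be ∷ []) ∷ (cd ∷ ce ∷ []) ∷ (de ∷ []) ∷ [] ∷ []))

    -- The co-chair is a pair of triangles `a d e` and `b d e` sharing the edge `d e`, with a
    -- pendant vertex `c` at `a`.
    co-chair-free : a ~ c → a ~ d → a ~ e → b ~ d → b ~ e → d ~ e →
                    a ≁ b → b ≁ c → c ≁ d → c ≁ e → ⊥
    co-chair-free {a} {c} {d} {e} {b} ac ad ae bd be de ab bc cd ce = no-co-chair comb
      (inducedCopy co-chair (a ∷ b ∷ c ∷ d ∷ e ∷ [])
        ((ab ∷ ac ∷ ad ∷ ae ∷ []) ∷ (bc ∷ bd ∷ be ∷ []) ∷ (cd ∷ ce ∷ []) ∷ (de ∷ []) ∷ [] ∷ []))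

    -- If `u` and `u′` differ, every choice of the undetermined adjacencies exhibits a forbidden
    -- subgraph. The cases split on `f ~ w`; `x` and `x′` may coincide.
    alternating-unique : f ~ u → u ≁ w → w ~ x → x ≁ f →
                         f ~ u′ → u′ ≁ w → w ~ x′ → x′ ≁ f → u ≡ u′
    alternating-unique {f} {u} {w} {x} {u′} {x′} fu uw wx xf fu′ u′w wx′ x′f
      with u ≟ u′
    ... | yes u≡u′ = u≡u′
    ... | no u≢u′ = ⊥-elim (by-fw (~-or-≁ (~-≁⇒≢ fu uw)))
      where
      uf   = adj-sym G fu
      u′f  = adj-sym G fu′
      u≢x  = ~-≁⇒≢ uf (≁-sym xf)
      u≢x′ = ~-≁⇒≢ uf (≁-sym x′f)
      u′≢x  = ~-≁⇒≢ u′f (≁-sym xf)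
      u′≢x′ = ~-≁⇒≢ u′f (≁-sym x′f)
      xw   = adj-sym G wx
      x′w  = adj-sym G wx′

      -- For a common neighbour `y` of `u` and `u′`: if `u ~ u′`, the triangles over `u u′` with
      -- apexes `f` and `y`, and the pendant `w` at `y`, form a co-chair; otherwise `f u y u′` is an
      -- induced 4-cycle.
      diamond : ∀ {y} → y ~ w → y ≁ f → u ~ y → u′ ~ y → f ≁ w → ⊥
      diamond {y} yw yf uy u′y fw with ~-or-≁ u≢u′
      ... | inj₁ uu′ = co-chair-free yw (adj-sym G uy) (adj-sym G u′y) fu fu′ uu′
                         yf fw (≁-sym uw) (≁-sym u′w)
      ... | inj₂ uu′ = C₄-free fu uy (adj-sym G u′y) u′f (≁-sym yf) uu′

      -- Here `x` and `x′` differ, as `u` is adjacent to only one of them. The adjacencies of `u u′`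
      -- and `x x′` select a 4-cycle, a 5-cycle through `w`, a 5-cycle through `f`, or two disjoint
      -- edges.
      crossed : u ~ x → u′ ~ x′ → u ≁ x′ → u′ ≁ x → f ≁ w → ⊥
      crossed ux u′x′ ux′ u′x fw with ~-or-≁ u≢u′ | ~-or-≁ (λ { refl → proj₂ ux′ ux })
      ... | inj₁ uu′ | inj₁ xx′ = C₄-free uu′ u′x′ (adj-sym G xx′) (adj-sym G ux) ux′ u′x
      ... | inj₁ uu′ | inj₂ xx′ = C₅-free wx (adj-sym G ux) uu′ u′x′ x′w
                                    (≁-sym uw) (≁-sym u′w) (≁-sym u′x) xx′ ux′
      ... | inj₂ uu′ | inj₁ xx′ = C₅-free fu ux xx′ (adj-sym G u′x′) u′f
                                    (≁-sym xf) (≁-sym x′f) ux′ uu′ (≁-sym u′x)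
      ... | inj₂ uu′ | inj₂ xx′ = 2K₂-free ux u′x′ uu′ ux′ (≁-sym u′x) xx′

      tied : f ≁ w → u ~ x → u′ ~ x′ → ⊥
      tied fw ux u′x′ with ~-or-≁ u≢x′ | ~-or-≁ u′≢x
      ... | inj₁ ux′ | _        = diamond x′w x′f ux′ u′x′ fw
      ... | inj₂ _   | inj₁ u′x = diamond xw xf ux u′x fw
      ... | inj₂ ux′ | inj₂ u′x = crossed ux u′x′ ux′ u′x fw

      by-fw : f ~ w ⊎ f ≁ w → ⊥
      -- With `f ~ w`, an edge from `x` to `u` or `u′` closes a 4-cycle through `f w`. Otherwise
      -- `u u′` and `w x` are two disjoint edges, or the path `x w f` with leaves `u` and `u′` at
      -- `f` is a chair.
      by-fw (inj₁ fw) with ~-or-≁ u≢x | ~-or-≁ u′≢x | ~-or-≁ u≢u′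
      ... | inj₁ ux | _ | _ = C₄-free fu ux xw (adj-sym G fw) (≁-sym xf) uw
      ... | _ | inj₁ u′x | _ = C₄-free fu′ u′x xw (adj-sym G fw) (≁-sym xf) u′w
      ... | inj₂ ux | inj₂ u′x | inj₁ uu′ = 2K₂-free uu′ wx uw ux u′w u′x
      ... | inj₂ ux | inj₂ u′x | inj₂ uu′ =
        chair-free xw (adj-sym G fw) fu fu′ xf (≁-sym ux) (≁-sym u′x) (≁-sym uw) (≁-sym u′w) uu′
      by-fw (inj₂ fw) with ~-or-≁ u≢x | ~-or-≁ u′≢x′
      ... | inj₂ ux | _ = 2K₂-free fu wx fw (≁-sym xf) uw ux
      ... | _ | inj₂ u′x′ = 2K₂-free fu′ wx′ fw (≁-sym x′f) u′w u′x′
      ... | inj₁ ux | inj₁ u′x′ = tied fw ux u′x′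

-- Counting over lists

χ : ∀ {P : Set} → Dec P → ℕ
χ P? = if does P? then 1 else 0

χ-true : ∀ {P : Set} (P? : Dec P) → P → χ P? ≡ 1
χ-true (yes _) _ = refl
χ-true (no ¬p) p = contradiction p ¬p

χ-false : ∀ {P : Set} (P? : Dec P) → ¬ P → χ P? ≡ 0
χ-false (yes p) ¬p = contradiction p ¬p
χ-false (no _)  _  = refl

χ≤1 : ∀ {P : Set} (P? : Dec P) → χ P? ≤ 1
χ≤1 (yes _) = ≤-refl
χ≤1 (no _)  = z≤n

χ-mono : ∀ {P Q : Set} (P? : Dec P) (Q? : Dec Q) → (P → Q) → χ P? ≤ χ Q?
χ-mono (no _)  _  _   = z≤n
χ-mono (yes p) Q? P⇒Q = ≤-reflexive (sym (χ-true Q? (P⇒Q p)))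

χ-⊎ : ∀ {P Q R : Set} (P? : Dec P) (Q? : Dec Q) (R? : Dec R) → (P → Q ⊎ R) → χ P? ≤ χ Q? + χ R?
χ-⊎ (no _)  _  _  _ = z≤n
χ-⊎ (yes p) Q? R? P⇒Q⊎R with P⇒Q⊎R p
... | inj₁ q = ≤-trans (≤-reflexive (sym (χ-true Q? q))) (m≤m+n _ _)
... | inj₂ r = ≤-trans (≤-reflexive (sym (χ-true R? r))) (m≤n+m _ _)

module _ {A : Set} where

  private variable
    g h : A → ℕ
    xs ys : List A

  sumOver : (A → ℕ) → List A → ℕ
  sumOver g xs = sum (map g xs)

  sumOver-↭ : xs ↭ ys → sumOver g xs ≡ sumOver g ys
  sumOver-↭ {g = g} xs↭ys = sum-↭ (map⁺ g xs↭ys)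

  sumOver-mono : All (λ x → g x ≤ h x) xs → sumOver g xs ≤ sumOver h xs
  sumOver-mono []       = z≤n
  sumOver-mono (p ∷ ps) = +-mono-≤ p (sumOver-mono ps)

  sumOver-linear : ∀ k g h xs → sumOver (λ x → k * g x + h x) xs ≡ k * sumOver g xs + sumOver h xs
  sumOver-linear k g h []       = sym (cong (_+ 0) (*-zeroʳ k))
  sumOver-linear k g h (x ∷ xs) =
    trans (cong (k * g x + h x +_) (sumOver-linear k g h xs))
          (regroup k (g x) (h x) (sumOver g xs) (sumOver h xs))
    where
    regroup : ∀ k a b c d → k * a + b + (k * c + d) ≡ k * (a + c) + (b + d)
    regroup = solve-∀

  sumOver-+ : ∀ g h xs → sumOver (λ x → g x + h x) xs ≡ sumOver g xs + sumOver h xs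
  sumOver-+ g h []       = refl
  sumOver-+ g h (x ∷ xs) =
    trans (cong (g x + h x +_) (sumOver-+ g h xs))
          (interchange (g x) (h x) (sumOver g xs) (sumOver h xs))
    where
    interchange : ∀ a b c d → a + b + (c + d) ≡ a + c + (b + d)
    interchange = solve-∀

  sumOver-≤-length : (∀ x → g x ≤ 1) → ∀ xs → sumOver g xs ≤ length xs
  sumOver-≤-length g≤1 []       = z≤n
  sumOver-≤-length g≤1 (x ∷ xs) = +-mono-≤ (g≤1 x) (sumOver-≤-length g≤1 xs)

  sumOver-zero : All (λ x → g x ≡ 0) xs → sumOver g xs ≡ 0
  sumOver-zero []       = refl
  sumOver-zero (p ∷ ps) = cong₂ _+_ p (sumOver-zero ps)

  sumOver-χ≤1 : {P : Pred A 0ℓ} (P? : Decidable P) → (∀ {x y} → P x → P y → x ≡ y) →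
                Unique xs → sumOver (χ ∘ P?) xs ≤ 1
  sumOver-χ≤1 P? unique []  = z≤n
  sumOver-χ≤1 P? unique (_∷_ {x = x} x∉xs xs!) with P? x
  ... | no _  = sumOver-χ≤1 P? unique xs!
  ... | yes p = s≤s (≤-reflexive (sumOver-zero
                  (All.map (λ {y} x≢y → χ-false (P? y) (x≢y ∘ unique p)) x∉xs)))

  -- Lists represent vertex orders backwards: the head is the last vertex.
  score : (A → A → ℕ) → List A → ℕ
  score W []       = 0
  score W (x ∷ xs) = sumOver (λ y → W y x) xs + score W xs

  score-linear : ∀ k V W xs → score (λ y x → k * V y x + W y x) xs ≡ k * score V xs + score W xs
  score-linear k V W []       = sym (cong (_+ 0) (*-zeroʳ k))
  score-linear k V W (x ∷ xs) =
    trans (cong₂ _+_ (sumOver-linear k (λ y → V y x) (λ y → W y x) xs) (score-linear k V W xs))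
          (regroup k (sumOver (λ y → V y x) xs) (sumOver (λ y → W y x) xs)
                     (score V xs) (score W xs))
    where
    regroup : ∀ k a b c d → k * a + b + (k * c + d) ≡ k * (a + c) + (b + d)
    regroup = solve-∀

  score-bound : ∀ W → (∀ y x → W y x ≤ 1) → ∀ xs → score W xs ≤ length xs * length xs
  score-bound W W≤1 []       = z≤n
  score-bound W W≤1 (x ∷ xs) =
    ≤-trans (+-mono-≤ (sumOver-≤-length (λ y → W≤1 y x) xs) (score-bound W W≤1 xs))
            (*-monoʳ-≤ (suc (length xs)) (n≤1+n (length xs)))

  -- Moving the last vertex `w` to just before the block `ys` reverses only its pairs with `ys`,
  -- turning each `W y w` into `W w y`. The lost and gained sums stand on opposite sides to avoid
  -- subtraction.
  score-rotate : ∀ W w ys zs → score W (w ∷ ys ++ zs) + sumOver (W w) ys ≡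
                               score W (ys ++ w ∷ zs) + sumOver (λ y → W y w) ys
  score-rotate W w []       zs = refl
  score-rotate W w (y ∷ ys) zs = begin
    W y w + S w + (S y + R) + (W w y + sumOver (W w) ys)
      ≡⟨ swap₁ (W y w) (S w) (S y) R (W w y) (sumOver (W w) ys) ⟩
    W y w + W w y + S y + (S w + R + sumOver (W w) ys)
      ≡⟨ cong (W y w + W w y + S y +_) (score-rotate W w ys zs) ⟩
    W y w + W w y + S y + (score W (ys ++ w ∷ zs) + sumOver (λ y′ → W y′ w) ys)
      ≡⟨ swap₂ (W y w) (W w y) (S y) (score W (ys ++ w ∷ zs)) (sumOver (λ y′ → W y′ w) ys) ⟩
    W w y + S y + score W (ys ++ w ∷ zs) + (W y w + sumOver (λ y′ → W y′ w) ys)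
      ≡⟨ cong (λ s → s + score W (ys ++ w ∷ zs) + (W y w + sumOver (λ y′ → W y′ w) ys))
              (sumOver-↭ {g = λ y′ → W y′ y} (shift w ys zs)) ⟨
    sumOver (λ y′ → W y′ y) (ys ++ w ∷ zs) + score W (ys ++ w ∷ zs)
      + (W y w + sumOver (λ y′ → W y′ w) ys) ∎
    where
    open ≡-Reasoning
    S : A → ℕ
    S v = sumOver (λ y′ → W y′ v) (ys ++ zs)
    R = score W (ys ++ zs)
    swap₁ : ∀ a b c d e f → a + b + (c + d) + (e + f) ≡ a + e + c + (b + d + f)
    swap₁ = solve-∀
    swap₂ : ∀ a b c d e → a + b + c + (d + e) ≡ b + c + d + (a + e)
    swap₂ = solve-∀

  score-rotate-< : ∀ W w ys zs → sumOver (λ y → W y w) ys < sumOver (W w) ys →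
                   score W (w ∷ ys ++ zs) < score W (ys ++ w ∷ zs)
  score-rotate-< W w ys zs lt = +-cancelʳ-< _ _ _
    (<-≤-trans (+-monoʳ-< (score W (w ∷ ys ++ zs)) lt) (≤-reflexive (score-rotate W w ys zs)))

  -- Feedback and local optimality of orders

  prefix? : {P : Pred (List A) 0ℓ} → Decidable P → ∀ xs →
            (∀ ys zs → xs ≡ ys ++ zs → ¬ P ys) ⊎ (∃₂ λ ys zs → xs ≡ ys ++ zs × P ys)
  prefix? P? xs with P? []
  prefix? P? xs | yes p = inj₂ ([] , xs , refl , p)
  prefix? P? [] | no ¬p = inj₁ λ { [] _ _ → ¬p }
  prefix? P? (x ∷ xs) | no ¬p with prefix? (P? ∘ (x ∷_)) xs
  ... | inj₂ (ys , zs , eq , p) = inj₂ (x ∷ ys , zs , cong (x ∷_) eq , p)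
  ... | inj₁ none = inj₁ λ { [] _ _ → ¬p ; (_ ∷ ys) zs refl → none ys zs refl }

  -- As lists are read backwards, a prefix of `xs` is an interval of the order ending right before
  -- `w`. This is the feedback property of median orders at their last vertex.
  Feedback : (A → A → ℕ) → A → List A → Set
  Feedback W w xs = ∀ ys zs → xs ≡ ys ++ zs → sumOver (W w) ys ≤ sumOver (λ y → W y w) ys

  -- Local optimality under moving one vertex to an earlier place, instead of a global maximum of
  -- the score.
  Stable : (A → A → ℕ) → List A → Set
  Stable W xs = ∀ vs w ys → xs ≡ vs ++ w ∷ ys → Feedback W w ys

  feedback-or-rotate : ∀ W w xs → Feedback W w xs ⊎
    (∃₂ λ ys zs → xs ≡ ys ++ zs × sumOver (λ y → W y w) ys < sumOver (W w) ys)
  feedback-or-rotate W w xs with prefix? (λ ys → sumOver (λ y → W y w) ys <? sumOver (W w) ys) xs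
  ... | inj₁ none = inj₁ (λ ys zs eq → ≮⇒≥ (none ys zs eq))
  ... | inj₂ found = inj₂ found

  -- The contribution of `x` depends only on which vertices precede it, so an improvement within the
  -- tail improves the whole order.
  stable-or-improve : ∀ W xs → Stable W xs ⊎ (∃ λ ys → xs ↭ ys × score W xs < score W ys)
  stable-or-improve W [] = inj₁ λ { [] _ _ () ; (_ ∷ _) _ _ () }
  stable-or-improve W (x ∷ xs) with feedback-or-rotate W x xs | stable-or-improve W xs
  ... | inj₂ (ys , zs , refl , lt) | _ =
    inj₂ (ys ++ x ∷ zs , ↭-sym (shift x ys zs) , score-rotate-< W x ys zs lt)
  ... | inj₁ _ | inj₂ (ys , xs↭ys , lt) =
    inj₂ (x ∷ ys , prep x xs↭ys ,
          +-mono-≤-< (≤-reflexive (sumOver-↭ {g = λ y → W y x} xs↭ys)) lt)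
  ... | inj₁ fb | inj₁ st =
    inj₁ λ { [] _ _ refl → fb ; (_ ∷ vs) w ys refl → st vs w ys refl }

-- Hill climbing and lexicographically optimal orders

climb : {A : Set} {P : Pred A 0ℓ} (Φ : A → ℕ) (bound : ℕ) → (∀ a → Φ a ≤ bound) →
        (∀ a → P a ⊎ ∃ λ b → Φ a < Φ b) → A → ∃ P
climb {A} {P} Φ bound Φ≤ step a = go bound a (m≤n+m bound (Φ a))
  where
  -- The fuel covers the distance from `Φ a` to `bound`; once it is zero, no further rise is
  -- possible.
  go : ∀ fuel a → bound ≤ Φ a + fuel → ∃ P
  go fuel a le with step a
  go fuel a le | inj₁ p = a , p
  go zero a le | inj₂ (b , lt) =
    contradiction (≤-trans (Φ≤ b) (≤-trans le (≤-reflexive (+-identityʳ _)))) (<⇒≱ lt)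
  go (suc fuel) a le | inj₂ (b , lt) =
    go fuel b (≤-trans le (≤-trans (≤-reflexive (+-suc (Φ a) fuel)) (+-monoˡ-≤ fuel lt)))

module _ {A : Set} (p : A → A → ℕ) (q : A → A → A → ℕ)
         (p≤1 : ∀ y x → p y x ≤ 1) (q≤1 : ∀ f y x → q f y x ≤ 1) where

  -- suc M exceeds every score of q f, so that the p-score decides first and q f breaks ties.
  lexicographic-order : ∀ x xs → ∃ λ M → ∃₂ λ f ys → x ∷ xs ↭ f ∷ ys ×
    Feedback p f ys × Stable (λ y x → suc M * p y x + q f y x) ys
  lexicographic-order x₀ xs₀ =
    let ((f , ys , perm) , fb , st) = climb {A = State} Φ (N * M + M) Φ≤ step (x₀ , xs₀ , ↭-refl)
    in M , f , ys , perm , fb , st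
    where
    M = length (x₀ ∷ xs₀) * length (x₀ ∷ xs₀)
    N = suc M

    ω : A → A → A → ℕ
    ω f y x = N * p y x + q f y x

    State : Set
    State = ∃₂ λ f ys → x₀ ∷ xs₀ ↭ f ∷ ys

    Φ : State → ℕ
    Φ (f , ys , _) = N * score p (f ∷ ys) + score (q f) ys

    square≤M : ∀ {ys} → x₀ ∷ xs₀ ↭ ys → length ys * length ys ≤ M
    square≤M perm = ≤-reflexive (cong (λ m → m * m) (sym (↭-length perm)))

    q-score≤M : ∀ ((f , ys , _) : State) → score (q f) ys ≤ M
    q-score≤M (f , ys , perm) = begin
      score (q f) ys                          ≤⟨ score-bound (q f) (q≤1 f) ys ⟩
      length ys * length ys                   ≤⟨ *-mono-≤ (n≤1+n (length ys)) (n≤1+n (length ys)) ⟩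
      length (f ∷ ys) * length (f ∷ ys)       ≤⟨ square≤M perm ⟩
      M                                       ∎
      where open ≤-Reasoning

    Φ≤ : ∀ s → Φ s ≤ N * M + M
    Φ≤ s@(f , ys , perm) =
      +-mono-≤ (*-monoʳ-≤ N (≤-trans (score-bound p p≤1 (f ∷ ys)) (square≤M perm))) (q-score≤M s)

    -- For a fixed last vertex `f`, rearranging `ys` affects only the `ω f`-score.
    Φ-split : ∀ ((f , ys , perm) : State) →
              Φ (f , ys , perm) ≡ N * sumOver (λ y → p y f) ys + score (ω f) ys
    Φ-split (f , ys , _) = begin
      N * (sumOver (λ y → p y f) ys + score p ys) + score (q f) ys
        ≡⟨ cong (_+ score (q f) ys) (*-distribˡ-+ N (sumOver (λ y → p y f) ys) (score p ys)) ⟩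
      N * sumOver (λ y → p y f) ys + N * score p ys + score (q f) ys
        ≡⟨ +-assoc (N * sumOver (λ y → p y f) ys) _ _ ⟩
      N * sumOver (λ y → p y f) ys + (N * score p ys + score (q f) ys)
        ≡⟨ cong (N * sumOver (λ y → p y f) ys +_) (score-linear N p (q f) ys) ⟨
      N * sumOver (λ y → p y f) ys + score (ω f) ys ∎
      where open ≡-Reasoning

    p-score-first : ∀ (s@(f , ys , _) t@(g , zs , _) : State) →
                    score p (f ∷ ys) < score p (g ∷ zs) → Φ s < Φ t
    p-score-first s@(f , ys , _) t@(g , zs , _) lt = begin-strict
      N * score p (f ∷ ys) + score (q f) ys <⟨ +-monoʳ-< (N * score p (f ∷ ys)) (s≤s (q-score≤M s)) ⟩
      N * score p (f ∷ ys) + N              ≡⟨ +-comm (N * score p (f ∷ ys)) N ⟩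
      N + N * score p (f ∷ ys)              ≡⟨ *-suc N (score p (f ∷ ys)) ⟨
      N * suc (score p (f ∷ ys))            ≤⟨ *-monoʳ-≤ N lt ⟩
      N * score p (g ∷ zs)                  ≤⟨ m≤m+n _ _ ⟩
      Φ t                                   ∎
      where open ≤-Reasoning

    step : ∀ (s@(f , ys , _) : State) → (Feedback p f ys × Stable (ω f) ys) ⊎ (∃ λ t → Φ s < Φ t)
    step s@(f , ys , perm) with feedback-or-rotate p f ys | stable-or-improve (ω f) ys
    ... | inj₁ fb | inj₁ st = inj₁ (fb , st)
    -- The empty block would require `0 < 0`. So moving `f` makes some `y` the last vertex and
    -- replaces `q f` by `q y`; in that case the gain must come from the `p`-score alone.
    ... | inj₂ ([] , _ , _ , ()) | _
    ... | inj₂ (y ∷ us , zs , refl , lt) | _ =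
      let t = y , us ++ f ∷ zs , ↭-trans perm (↭-sym (shift f (y ∷ us) zs))
      in inj₂ (t , p-score-first s t (score-rotate-< p f (y ∷ us) zs lt))
    ... | inj₁ _ | inj₂ (zs , ys↭zs , lt) =
      let t = f , zs , ↭-trans perm (prep f ys↭zs)
      in inj₂ (t , (begin-strict
        Φ s                                           ≡⟨ Φ-split s ⟩
        N * sumOver (λ y → p y f) ys + score (ω f) ys <⟨ +-monoʳ-< (N * sumOver (λ y → p y f) ys) lt ⟩
        N * sumOver (λ y → p y f) ys + score (ω f) zs ≡⟨ cong (λ a → N * a + score (ω f) zs)
                                                              (sumOver-↭ {g = λ y → p y f} ys↭zs) ⟩
        N * sumOver (λ y → p y f) zs + score (ω f) zs ≡⟨ Φ-split t ⟨
        Φ t                                           ∎))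
      where open ≤-Reasoning

-- Cutting xs at its bad entries reduces the comparison to blocks without bad entries.
blockwise-≤ : {A : Set} {Bad : Pred A 0ℓ} (bad? : Decidable Bad) (g h : A → ℕ) →
  (∀ {w} → Bad w → g w ≡ 0) → ∀ xs →
  (∀ ys zs → xs ≡ ys ++ zs → All (¬_ ∘ Bad) ys → sumOver g ys ≤ sumOver h ys) →
  (∀ vs w ys zs → xs ≡ vs ++ w ∷ ys ++ zs → Bad w → All (¬_ ∘ Bad) ys →
    sumOver g ys ≤ sumOver h ys) →
  sumOver g xs ≤ sumOver h xs
blockwise-≤ {A} {Bad} bad? g h g-bad = λ xs → go xs 0 0
  where
  -- `a` and `b` hold the sums of `g` and `h` over the part of the current block already read.
  go : ∀ xs a b →
    (∀ ys zs → xs ≡ ys ++ zs → All (¬_ ∘ Bad) ys → a + sumOver g ys ≤ b + sumOver h ys) →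
    (∀ vs w ys zs → xs ≡ vs ++ w ∷ ys ++ zs → Bad w → All (¬_ ∘ Bad) ys →
      sumOver g ys ≤ sumOver h ys) →
    a + sumOver g xs ≤ b + sumOver h xs
  go [] a b first _ = first [] [] refl []
  go (x ∷ xs) a b first rest with bad? x
  ... | no ¬bad = begin
    a + (g x + sumOver g xs) ≡⟨ +-assoc a (g x) _ ⟨
    a + g x + sumOver g xs   ≤⟨ go xs (a + g x) (b + h x) first′
                                  (λ { vs w ys zs refl → rest (x ∷ vs) w ys zs refl }) ⟩
    b + h x + sumOver h xs   ≡⟨ +-assoc b (h x) _ ⟩
    b + (h x + sumOver h xs) ∎
    where
    open ≤-Reasoning
    first′ : ∀ ys zs → xs ≡ ys ++ zs → All (¬_ ∘ Bad) ys →
             a + g x + sumOver g ys ≤ b + h x + sumOver h ys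
    first′ ys zs refl ¬bads = begin
      a + g x + sumOver g ys   ≡⟨ +-assoc a (g x) _ ⟩
      a + (g x + sumOver g ys) ≤⟨ first (x ∷ ys) zs refl (¬bad ∷ ¬bads) ⟩
      b + (h x + sumOver h ys) ≡⟨ +-assoc b (h x) _ ⟨
      b + h x + sumOver h ys   ∎
  -- A bad entry ends the block: `first` at the empty list gives `a ≤ b`. The entry adds nothing to
  -- the left side, and `rest` governs the new block after it.
  ... | yes bad = begin
    a + (g x + sumOver g xs) ≡⟨ cong (λ c → a + (c + sumOver g xs)) (g-bad bad) ⟩
    a + sumOver g xs         ≤⟨ +-mono-≤ a≤b
                                  (≤-trans (go xs 0 0
                                      (λ { ys zs refl → rest [] x ys zs refl bad })
                                      (λ { vs w ys zs refl → rest (x ∷ vs) w ys zs refl }))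
                                    (m≤n+m _ (h x))) ⟩
    b + (h x + sumOver h xs) ∎
    where
    open ≤-Reasoning
    a≤b : a ≤ b
    a≤b = +-cancelʳ-≤ 0 a b (first [] (x ∷ xs) refl [])

Unique-++⁻ : ∀ {A : Set} (xs : List A) {ys} → Unique (xs ++ ys) → Unique xs × Unique ys
Unique-++⁻ []       ys! = [] , ys!
Unique-++⁻ (x ∷ xs) (x∉ ∷ xs!) with xs! , ys! ← Unique-++⁻ xs xs! = (++⁻ˡ xs x∉ ∷ xs!) , ys!

∣subsetOf∣ : ∀ {n} {P : Pred (Fin n) 0ℓ} (P? : Decidable P) →
             ∣ subsetOf P? ∣ ≡ sumOver (χ ∘ P?) (allFin n)
∣subsetOf∣ {n} P? = trans (count-tabulate n (does ∘ P?)) (cong sum (sym (map-tabulate id (χ ∘ P?))))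
  where
  count-tabulate : ∀ n b →
    ∣ Vec.tabulate {n = n} b ∣ ≡ sum (List.tabulate (λ i → if b i then 1 else 0))
  count-tabulate zero    b = refl
  count-tabulate (suc n) b with b zero
  ... | true  = cong suc (count-tabulate n (b ∘ suc))
  ... | false = count-tabulate n (b ∘ suc)

-- How a tie pays for a missing domination: if `s` is 1, the weighted inequality forces `a < b`,
-- which leaves room for one more on the left.
absorb-tie : ∀ M a b s → s ≤ 1 → suc M * a + s ≤ suc M * b → a + s ≤ b
absorb-tie M a b 0 _ le =
  subst (_≤ b) (sym (+-identityʳ a)) (*-cancelˡ-≤ (suc M) (subst (_≤ suc M * b) (+-identityʳ _) le))
absorb-tie M a b 1 _ le =
  subst (_≤ b) (+-comm 1 a) (*-cancelˡ-< (suc M) a b (subst (_≤ suc M * b) (+-comm _ 1) le))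
absorb-tie M a b (suc (suc _)) (s≤s ()) _

-- Oriented combs

module _ {n : ℕ} (G : Graph n) (comb : IsComb G) (D : Digraph n) (orient : IsOrientation G D) where

  open Graph G
  open Graph (complement G) using () renaming (Adj to NonAdj)
  open Digraph D
  open IsOrientation orient

  Reaches : Fin n → Fin n → Set
  Reaches v w = Arc v w ⊎ ∃ λ u → Arc v u × Arc u w

  reaches? : ∀ v w → Dec (Reaches v w)
  reaches? v w = arc? v w ⊎-dec any? (λ u → arc? v u ×-dec arc? u w)

  -- Both orientations of a missing edge may be convenient. Loops, and possibly reversed arcs, are
  -- included too; this is harmless, since no convenient pair leads from N⁺(f) to a vertex that f
  -- does not reach.
  Convenient : Fin n → Fin n → Set
  Convenient u w = ∀ v → Arc v u → Reaches v w

  convenient? : ∀ u w → Dec (Convenient u w)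
  convenient? u w = all? (λ v → arc? v u →-dec reaches? v w)

  arc⇒convenient : ∀ {u w} → Arc u w → Convenient u w
  arc⇒convenient uw v vu = inj₂ (_ , vu , uw)

  arc-irrefl : ∀ {v} → ¬ Arc v v
  arc-irrefl vv = arc-asym vv vv

  ¬reaches-self : ∀ {v} → ¬ Reaches v v
  ¬reaches-self (inj₁ vv) = arc-irrefl vv
  ¬reaches-self (inj₂ (_ , vu , uv)) = arc-asym vu uv

  nonadjacent : ∀ {u v} → u ≢ v → ¬ Arc u v → ¬ Arc v u → NonAdj u v
  nonadjacent {u} {v} u≢v ¬uv ¬vu = u≢v , λ adj → [ ¬uv , ¬vu ]′ (adj⇒arc adj)

  Tie : Fin n → Fin n → Fin n → Set
  Tie f w u = Arc f u × ¬ Reaches f w × ¬ Convenient w u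

  tie? : ∀ f w u → Dec (Tie f w u)
  tie? f w u = arc? f u ×-dec ¬? (reaches? f w) ×-dec ¬? (convenient? w u)

  -- Failure of convenience yields an in-neighbour `x` of `w` that does not reach `u`. An arc
  -- between `u` and `w`, or between `x` and `f`, would let `f` reach `w`, let `x` reach `u`, or
  -- make the pair `w`, `u` convenient.
  tie⇒alternating : ∀ {f w u} → Tie f w u →
                    Adj f u × NonAdj u w × ∃ λ x → Adj w x × NonAdj x f
  tie⇒alternating {f} {w} {u} (fu , ¬fw , ¬wu)
    with x , ¬conv ← ¬∀⟶∃¬ n _ (λ v → arc? v w →-dec reaches? v u) ¬wu
    with arc? x w
  ... | no ¬xw = contradiction (λ xw → contradiction xw ¬xw) ¬conv
  ... | yes xw =
    arc⇒adj fu ,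
    nonadjacent (λ { refl → ¬fw (inj₁ fu) }) (λ uw → ¬fw (inj₂ (u , fu , uw)))
      (¬wu ∘ arc⇒convenient) ,
    x , adj-sym (arc⇒adj xw) ,
    nonadjacent (λ { refl → ¬fw (inj₁ xw) }) (λ xf → ¬xu (inj₂ (f , xf , fu)))
      (λ fx → ¬fw (inj₂ (x , fx , xw)))
    where
    ¬xu : ¬ Reaches x u
    ¬xu xu = ¬conv (λ _ → xu)

  tie-unique : ∀ {f w u u′} → Tie f w u → Tie f w u′ → u ≡ u′
  tie-unique t t′
    with fu , uw , x , wx , xf ← tie⇒alternating t
    with fu′ , u′w , x′ , wx′ , x′f ← tie⇒alternating t′
    = alternating-unique G comb fu uw wx xf fu′ u′w wx′ x′f

  -- Weights and the blockwise comparison of out-neighbourhoods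

  p : Fin n → Fin n → ℕ
  p y x = χ (convenient? y x)

  q : Fin n → Fin n → Fin n → ℕ
  q f y x = χ (tie? f y x)

  out second : Fin n → Fin n → ℕ
  out f x    = χ (arc? f x)
  second f x = χ (secondOutNeighbour? D f x)

  reached-second : ∀ {f x} → Reaches f x → ¬ Arc f x → SecondOutNeighbour D f x
  reached-second (inj₁ fx) ¬fx = contradiction fx ¬fx
  reached-second r@(inj₂ path) ¬fx = (λ { refl → ¬reaches-self r }) , ¬fx , path

  -- Were `x` an out-neighbour of `f`, convenience would let `f` reach `w`; so `x` is reached in two
  -- steps only. The case where `w` is `f` itself serves the first block.
  convenient-to-unreached : ∀ {f w x} → ¬ Reaches f w → Reaches f x → p x w ≤ second f x
  convenient-to-unreached {f} {w} {x} ¬fw fx = χ-mono (convenient? x w) (secondOutNeighbour? D f x)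
    (λ xw → reached-second fx (λ f→x → ¬fw (xw f f→x)))

  out≤p+q : ∀ {f w} x → ¬ Reaches f w → out f x ≤ p w x + q f w x
  out≤p+q {f} {w} x ¬fw = χ-⊎ (arc? f x) (convenient? w x) (tie? f w x) convenient-or-tie
    where
    convenient-or-tie : Arc f x → Convenient w x ⊎ Tie f w x
    convenient-or-tie fx with convenient? w x
    ... | yes wx = inj₁ wx
    ... | no ¬wx = inj₂ (fx , ¬fw , ¬wx)

  -- The order is cut at the vertices that `f` does not reach. The block next to `f` is settled by
  -- the feedback at `f`, every other block by the feedback at the unreached `w` right after it in
  -- the order.
  sum-out≤sum-second : ∀ f xs M → Unique xs → Feedback p f xs →
    Stable (λ y x → suc M * p y x + q f y x) xs → sumOver (out f) xs ≤ sumOver (second f) xs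
  sum-out≤sum-second f xs M xs! fb st =
    blockwise-≤ (λ w → ¬? (reaches? f w)) (out f) (second f)
      (λ {w} ¬fw → χ-false (arc? f w) (¬fw ∘ inj₁)) xs first-block later-block
    where
    open ≤-Reasoning

    reached : ∀ {ys} → All (λ y → ¬ ¬ Reaches f y) ys → All (Reaches f) ys
    reached = All.map (λ {y} → decidable-stable (reaches? f y))

    first-block : ∀ ys zs → xs ≡ ys ++ zs → All (λ y → ¬ ¬ Reaches f y) ys →
                  sumOver (out f) ys ≤ sumOver (second f) ys
    first-block ys zs eq fys = begin
      sumOver (out f) ys
        ≤⟨ sumOver-mono (All.universal
             (λ y → χ-mono (arc? f y) (convenient? f y) arc⇒convenient) ys) ⟩
      sumOver (p f) ys
        ≤⟨ fb ys zs eq ⟩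
      sumOver (λ y → p y f) ys
        ≤⟨ sumOver-mono (All.map (convenient-to-unreached ¬reaches-self) (reached fys)) ⟩
      sumOver (second f) ys ∎

    later-block : ∀ vs w ys zs → xs ≡ vs ++ w ∷ ys ++ zs → ¬ Reaches f w →
                  All (λ y → ¬ ¬ Reaches f y) ys → sumOver (out f) ys ≤ sumOver (second f) ys
    later-block vs w ys zs refl ¬fw fys = begin
      sumOver (out f) ys
        ≤⟨ sumOver-mono (All.universal (λ y → out≤p+q y ¬fw) ys) ⟩
      sumOver (λ y → p w y + q f w y) ys
        ≡⟨ sumOver-+ (p w) (q f w) ys ⟩
      sumOver (p w) ys + sumOver (q f w) ys
        ≤⟨ absorb-tie M _ _ _ ties≤1 weighted ⟩
      sumOver (λ y → p y w) ys
        ≤⟨ sumOver-mono (All.map (convenient-to-unreached ¬fw) (reached fys)) ⟩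
      sumOver (second f) ys ∎
      where
      ties≤1 : sumOver (q f w) ys ≤ 1
      ties≤1 with _ ∷ ys++zs! ← proj₂ (Unique-++⁻ vs xs!) =
        sumOver-χ≤1 (tie? f w) tie-unique (proj₁ (Unique-++⁻ ys ys++zs!))

      -- A tie here would need an unreached `y`, but the block has only reached vertices. Thus the
      -- tie-break weight appears on one side only and can repay the deficit.
      no-ties : sumOver (λ y → q f y w) ys ≡ 0
      no-ties = sumOver-zero
        (All.map (λ {y} ¬¬fy → χ-false (tie? f y w) (¬¬fy ∘ proj₁ ∘ proj₂)) fys)

      weighted : suc M * sumOver (p w) ys + sumOver (q f w) ys ≤ suc M * sumOver (λ y → p y w) ys
      weighted = begin
        suc M * sumOver (p w) ys + sumOver (q f w) ys
          ≡⟨ sumOver-linear (suc M) (p w) (q f w) ys ⟨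
        sumOver (λ y → suc M * p w y + q f w y) ys
          ≤⟨ st vs w (ys ++ zs) refl ys zs refl ⟩
        sumOver (λ y → suc M * p y w + q f y w) ys
          ≡⟨ sumOver-linear (suc M) (λ y → p y w) (λ y → q f y w) ys ⟩
        suc M * sumOver (λ y → p y w) ys + sumOver (λ y → q f y w) ys
          ≡⟨ cong (suc M * sumOver (λ y → p y w) ys +_) no-ties ⟩
        suc M * sumOver (λ y → p y w) ys + 0
          ≡⟨ +-identityʳ _ ⟩
        suc M * sumOver (λ y → p y w) ys ∎

corollary6 : (n : ℕ) .{{_ : NonZero n}} (G : Graph n) → IsComb G →
    (D : Digraph n) → IsOrientation G D →
    ∃ λ v → d⁺ D v ≤ d⁺⁺ D v
corollary6 n@(suc _) G comb D orient
  with M , f , ys , perm , fb , st ← lexicographic-order (p G comb D orient) (q G comb D orient)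
         (λ y x → χ≤1 (convenient? G comb D orient y x))
         (λ f y x → χ≤1 (tie? G comb D orient f y x))
         zero (List.tabulate suc)
  with _ ∷ ys! ← Unique-resp-↭ (setoid _) (↭⇒↭ₛ perm) (allFin⁺ n)
  = f , (begin
    d⁺ D f
      ≡⟨ ∣subsetOf∣ (arc? f) ⟩
    sumOver (χ ∘ arc? f) (allFin n)
      ≡⟨ sumOver-↭ perm ⟩
    χ (arc? f f) + sumOver (χ ∘ arc? f) ys
      ≡⟨ cong (_+ sumOver (χ ∘ arc? f) ys) (χ-false (arc? f f) (arc-irrefl G comb D orient)) ⟩
    sumOver (χ ∘ arc? f) ys
      ≤⟨ sum-out≤sum-second G comb D orient f ys M ys! fb st ⟩
    sumOver (χ ∘ secondOutNeighbour? D f) ys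
      ≤⟨ m≤n+m _ (χ (secondOutNeighbour? D f f)) ⟩
    sumOver (χ ∘ secondOutNeighbour? D f) (f ∷ ys)
      ≡⟨ sumOver-↭ perm ⟨
    sumOver (χ ∘ secondOutNeighbour? D f) (allFin n)
      ≡⟨ ∣subsetOf∣ (secondOutNeighbour? D f) ⟨
    d⁺⁺ D f ∎)
  where
  open ≤-Reasoning
  open Digraph D
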